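{- For every graph $G$, $\operatorname{box}(G)\le \min\{2\,MED(G)+2,\ MED(\overline{G})\}$, where $\overline{G}$ is the complement of $G$.
   Context: A dominating edge set of a graph $H$ is a set $D$ of edges such that every edge of $H$ not in $D$ shares an endpoint with some edge of $D$; $MED(H)$ is the minimum cardinality of a dominating edge set of $H$. The boxicity $\operatorname{box}(G)$ is the minimum $b$ such that $G$ is the intersection graph of axis-parallel boxes in $\mathbb{R}^b$ (products of $b$ closed intervals), one box per vertex. -}

module Defs where

open import Data.Empty using (⊥-elim)
open import Data.Fin.Base as Fin using (Fin; toℕ; fromℕ<; finToFun; funToFin)
open import Data.Fin.Properties as Finₚ using (any?; all?; toℕ-fromℕ<; finToFun-funToFin)
open import Data.Fin.Subset using (Subset; _∈_; _∉_; ∣_∣; ⊤)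
open import Data.Fin.Subset.Properties using (_∈?_; anySubset?; ∈⊤; ∣p∣≤n; p⊆q⇒∣p∣≤∣q∣; p⊂q⇒∣p∣<∣q∣)
import Data.Integer.Base as ℤ
import Data.Integer.Properties as ℤₚ
open import Data.List.Base using (List; length; lookup; filter; allFin; cartesianProduct)
open import Data.Nat.Base using (ℕ; zero; suc; _+_; _≤_; _<_; _⊔_; _^_; z≤n; s≤s)
import Data.Nat.Properties as ℕₚ
open import Data.Nat.Coprimality as Coprime using (1-coprimeTo)
open import Data.Product.Base using (∃; ∃-syntax; Σ-syntax; _×_; _,_; proj₁; proj₂)
open import Data.Rational.Base as ℚ using (ℚ; mkℚ; *≤*)
import Data.Rational.Properties as ℚₚ
open import Data.Sum.Base using (_⊎_; inj₁; inj₂)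
import Data.Vec.Base as Vec
open import Data.Vec.Properties using (lookup∘tabulate; lookup⇒[]=; []=⇒lookup)
open import Function.Base using (_∘_; id)
open import Function.Bundles using (_⇔_; mk⇔; module Equivalence)
open import Level using (0ℓ)
open import Relation.Binary.Core using (Rel)
open import Relation.Binary.Definitions using (Decidable; Symmetric; tri<; tri≈; tri>)
open import Relation.Binary.PropositionalEquality using (_≡_; _≢_; refl; sym; trans; cong; subst; subst₂)
open import Relation.Nullary using (¬_; Dec; yes; no; does; contradiction)
open import Relation.Nullary.Decidable using (map′; _×-dec_; _⊎-dec_; _→-dec_; ¬?; decidable-stable; ¬¬-excluded-middle; dec-true; dec-false)
import Relation.Unary as U

IsLeast : ∀ {ℓ} → (ℕ → Set ℓ) → ℕ → Set ℓ
IsLeast P m = P m × (∀ k → P k → m ≤ k)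

least : ∀ {ℓ} {P : ℕ → Set ℓ} → U.Decidable P → ∀ m → P m → ∃ (IsLeast P)
least P? zero p = zero , p , λ _ _ → z≤n
least P? (suc m) p with P? zero
... | yes p₀ = zero , p₀ , λ _ _ → z≤n
... | no ¬p₀ with least (P? ∘ suc) m p
...   | k , pk , k-min = suc k , pk , λ where
          zero    p₀ → contradiction p₀ ¬p₀
          (suc j) pj → s≤s (k-min j pj)

record Graph (n : ℕ) : Set₁ where
  field
    Adj    : Rel (Fin n) 0ℓ
    adj?   : Decidable Adj
    symm   : Symmetric Adj
    irrefl : ∀ v → ¬ Adj v v

open Graph public

complement : ∀ {n} → Graph n → Graph n
complement G = record
  { Adj    = λ u v → u ≢ v × ¬ Adj G u v
  ; adj?   = λ u v → ¬? (u Finₚ.≟ v) ×-dec ¬? (adj? G u v)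
  ; symm   = λ (u≢v , ¬uv) → u≢v ∘ sym , ¬uv ∘ symm G
  ; irrefl = λ v (v≢v , _) → v≢v refl
  }

-- Each edge {u , v} is listed exactly once, as the pair with u < v.
edges : ∀ {n} → Graph n → List (Fin n × Fin n)
edges {n} G = filter (λ (u , v) → (u Finₚ.<? v) ×-dec adj? G u v)
                     (cartesianProduct (allFin n) (allFin n))

EdgeIx : ∀ {n} → Graph n → Set
EdgeIx G = Fin (length (edges G))

EdgeSet : ∀ {n} → Graph n → Set
EdgeSet G = Subset (length (edges G))

EndpointOf : ∀ {n} → Fin n → Fin n × Fin n → Set
EndpointOf w (u , v) = w ≡ u ⊎ w ≡ v

ShareEndpoint : ∀ {n} (G : Graph n) → EdgeIx G → EdgeIx G → Set
ShareEndpoint G e f =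
  ∃[ w ] EndpointOf w (lookup (edges G) e) × EndpointOf w (lookup (edges G) f)

Dominating : ∀ {n} (G : Graph n) → EdgeSet G → Set
Dominating G D = ∀ e → e ∉ D → ∃[ d ] d ∈ D × ShareEndpoint G e d

HasDominatingEdgeSet : ∀ {n} → Graph n → ℕ → Set
HasDominatingEdgeSet G k = ∃[ D ] Dominating G D × ∣ D ∣ ≡ k

hasDominatingEdgeSet? : ∀ {n} (G : Graph n) → U.Decidable (HasDominatingEdgeSet G)
hasDominatingEdgeSet? G k = anySubset? λ D → dominating? D ×-dec (∣ D ∣ ℕₚ.≟ k)
  where
  endpointOf? : ∀ {n} (w : Fin n) e → Dec (EndpointOf w e)
  endpointOf? w (u , v) = (w Finₚ.≟ u) ⊎-dec (w Finₚ.≟ v)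

  dominating? : U.Decidable (Dominating G)
  dominating? D = all? λ e → ¬? (e ∈? D) →-dec any? λ d → (d ∈? D) ×-dec
    any? λ w → endpointOf? w (lookup (edges G) e) ×-dec endpointOf? w (lookup (edges G) d)

leastDominating : ∀ {n} (G : Graph n) → ∃ (IsLeast (HasDominatingEdgeSet G))
leastDominating G = least (hasDominatingEdgeSet? G)
  ∣ ⊤ {length (edges G)} ∣ (⊤ , (λ e e∉⊤ → contradiction ∈⊤ e∉⊤) , refl)

MED : ∀ {n} → Graph n → ℕ
MED G = proj₁ (leastDominating G)

MED-isLeast : ∀ {n} (G : Graph n) → IsLeast (HasDominatingEdgeSet G) (MED G)
MED-isLeast G = proj₂ (leastDominating G)

-- Two-sided Dedekind cuts: L and U hold the rationals strictly below and
-- strictly above the real.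
record ℝ : Set₁ where
  field
    L U         : ℚ → Set
    L-inhabited : ∃ L
    U-inhabited : ∃ U
    L-lower     : ∀ {q r} → q ℚ.< r → L r → L q
    U-upper     : ∀ {q r} → q ℚ.< r → U q → U r
    L-open      : ∀ {q} → L q → ∃[ r ] q ℚ.< r × L r
    U-open      : ∀ {r} → U r → ∃[ q ] q ℚ.< r × U q
    disjoint    : ∀ q → ¬ (L q × U q)
    located     : ∀ {q r} → q ℚ.< r → L q ⊎ U r

infix 4 _≤ᴿ_

_≤ᴿ_ : ℝ → ℝ → Set
x ≤ᴿ y = ∀ q → ℝ.L x q → ℝ.L y q

≤ᴿ-refl : ∀ {x} → x ≤ᴿ x
≤ᴿ-refl q = id

≤ᴿ-trans : ∀ {x y z} → x ≤ᴿ y → y ≤ᴿ z → x ≤ᴿ z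
≤ᴿ-trans x≤y y≤z q = y≤z q ∘ x≤y q

≰ᴿ⇒≥ᴿ : ∀ {x y} → ¬ x ≤ᴿ y → y ≤ᴿ x
≰ᴿ⇒≥ᴿ {x} {y} x≰y q q∈Ly with ℝ.L-open y q∈Ly
... | r , q<r , r∈Ly with ℝ.located x q<r
...   | inj₁ q∈Lx = q∈Lx
...   | inj₂ r∈Ux = contradiction x≤y x≰y
  where
  x≤y : x ≤ᴿ y
  x≤y s s∈Lx with ℚₚ.<-cmp s r
  ... | tri< s<r _ _ = ℝ.L-lower y s<r r∈Ly
  ... | tri≈ _ refl _ = r∈Ly
  ... | tri> _ _ r<s = ⊥-elim (ℝ.disjoint x r (ℝ.L-lower x r<s s∈Lx , r∈Ux))

fromℚ : ℚ → ℝ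
fromℚ p = record
  { L           = ℚ._< p
  ; U           = p ℚ.<_
  ; L-inhabited = p ℚ.- ℚ.1ℚ , subst (p ℚ.- ℚ.1ℚ ℚ.<_) (ℚₚ.+-identityʳ p)
                    (ℚₚ.+-monoʳ-< p { ℚ.- ℚ.1ℚ } {ℚ.0ℚ} (ℚ.*<* ℤ.-<+))
  ; U-inhabited = p ℚ.+ ℚ.1ℚ , subst (ℚ._< p ℚ.+ ℚ.1ℚ) (ℚₚ.+-identityʳ p)
                    (ℚₚ.+-monoʳ-< p {ℚ.0ℚ} {ℚ.1ℚ} (ℚ.*<* (ℤ.+<+ (s≤s z≤n))))
  ; L-lower     = ℚₚ.<-trans
  ; U-upper     = λ q<r p<q → ℚₚ.<-trans p<q q<r
  ; L-open      = λ q<p → let r , q<r , r<p = ℚₚ.<-dense q<p in r , q<r , r<p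
  ; U-open      = λ p<r → let q , p<q , q<r = ℚₚ.<-dense p<r in q , q<r , p<q
  ; disjoint    = λ q (q<p , p<q) → ℚₚ.<-asym q<p p<q
  ; located     = located
  }
  where
  located : ∀ {q r} → q ℚ.< r → q ℚ.< p ⊎ p ℚ.< r
  located {q} {r} q<r with q ℚₚ.<? p
  ... | yes q<p = inj₁ q<p
  ... | no  q≮p = inj₂ (ℚₚ.≤-<-trans (ℚₚ.≮⇒≥ q≮p) q<r)

fromℚ-mono : ∀ {p q} → p ℚ.≤ q → fromℚ p ≤ᴿ fromℚ q
fromℚ-mono p≤q r r<p = ℚₚ.<-≤-trans r<p p≤q

fromℚ-cancel : ∀ {p q} → fromℚ p ≤ᴿ fromℚ q → p ℚ.≤ q
fromℚ-cancel {p} {q} h = ℚₚ.≮⇒≥ λ q<p → ℚₚ.<-irrefl refl (h q q<p)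

fromℕ : ℕ → ℝ
fromℕ m = fromℚ (mkℚ (ℤ.+ m) 0 (Coprime.sym (1-coprimeTo m)))

fromℕ-mono : ∀ {m n} → m ≤ n → fromℕ m ≤ᴿ fromℕ n
fromℕ-mono m≤n = fromℚ-mono (*≤* (ℤₚ.*-monoʳ-≤-nonNeg ℤ.1ℤ (ℤ.+≤+ m≤n)))

fromℕ-cancel : ∀ {m n} → fromℕ m ≤ᴿ fromℕ n → m ≤ n
fromℕ-cancel {m} {n} h = ℤₚ.drop‿+≤+
  (subst₂ ℤ._≤_ (ℤₚ.*-identityʳ (ℤ.+ m)) (ℤₚ.*-identityʳ (ℤ.+ n)) (ℚₚ.drop-*≤* (fromℚ-cancel h)))

record Box (b : ℕ) : Set₁ where
  field
    lo hi : Fin b → ℝ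
    lo≤hi : ∀ i → lo i ≤ᴿ hi i

open Box public

infix 4 _∈ᴮ_

_∈ᴮ_ : ∀ {b} → (Fin b → ℝ) → Box b → Set
p ∈ᴮ B = ∀ i → lo B i ≤ᴿ p i × p i ≤ᴿ hi B i

Intersect : ∀ {b} → Box b → Box b → Set₁
Intersect A B = ∃[ p ] p ∈ᴮ A × p ∈ᴮ B

IsBoxRepresentation : ∀ {n b} → Graph n → (Fin n → Box b) → Set₁
IsBoxRepresentation G B = ∀ u v → u ≢ v → Adj G u v ⇔ Intersect (B u) (B v)

-- In dimension 0 all boxes coincide, so exactly the complete graphs (including
-- those with at most one vertex) are representable.
HasBoxRepresentation : ∀ {n} → Graph n → ℕ → Set₁
HasBoxRepresentation {n} G b = Σ[ B ∈ (Fin n → Box b) ] IsBoxRepresentation G B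

-- Representability in ℝᵇ is decidable: only the relative order of the
-- endpoints matters, so it reduces to endpoints in {0,…,n+1}.

Overlap : ∀ {n b} (l h : Fin n → Fin b → ℕ) → Rel (Fin n) 0ℓ
Overlap l h u v = ∀ i → l u i ≤ h v i × l v i ≤ h u i

IsGridRepresentation : ∀ {n b} → Graph n → (l h : Fin n → Fin b → ℕ) → Set
IsGridRepresentation G l h =
  (∀ u i → l u i ≤ h u i) × (∀ u v → u ≢ v → Adj G u v ⇔ Overlap l h u v)

grid⇒box : ∀ {n b} (G : Graph n) {l h : Fin n → Fin b → ℕ} →
           IsGridRepresentation G l h → HasBoxRepresentation G b
grid⇒box G {l} {h} (l≤h , rep) = B , λ u v u≢v → mk⇔
  (λ uv → let o = Equivalence.to (rep u v u≢v) uv in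
    (λ i → fromℕ (l u i ⊔ l v i)) ,
    (λ i → fromℕ-mono (ℕₚ.m≤m⊔n (l u i) (l v i)) ,
           fromℕ-mono (ℕₚ.⊔-lub (l≤h u i) (proj₂ (o i)))) ,
    (λ i → fromℕ-mono (ℕₚ.m≤n⊔m (l u i) (l v i)) ,
           fromℕ-mono (ℕₚ.⊔-lub (proj₁ (o i)) (l≤h v i))))
  (λ (p , p∈u , p∈v) → Equivalence.from (rep u v u≢v) λ i →
    fromℕ-cancel (≤ᴿ-trans {fromℕ (l u i)} {p i} {fromℕ (h v i)} (proj₁ (p∈u i)) (proj₂ (p∈v i))) ,
    fromℕ-cancel (≤ᴿ-trans {fromℕ (l v i)} {p i} {fromℕ (h u i)} (proj₁ (p∈v i)) (proj₂ (p∈u i))))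
  where
  B : _ → Box _
  B u = record
    { lo    = λ i → fromℕ (l u i)
    ; hi    = λ i → fromℕ (h u i)
    ; lo≤hi = λ i → fromℕ-mono (l≤h u i)
    }

¬¬-∀ : ∀ {ℓ n} {P : Fin n → Set ℓ} → (∀ i → ¬ ¬ P i) → ¬ ¬ (∀ i → P i)
¬¬-∀ {n = zero}  p k = k λ ()
¬¬-∀ {n = suc n} p k = p Fin.zero λ p₀ → ¬¬-∀ (p ∘ Fin.suc) λ ps →
  k λ { Fin.zero → p₀ ; (Fin.suc i) → ps i }

module _ {n} {P : Fin n → Set} (P? : U.Decidable P) where
  ⟪_⟫ : Subset n
  ⟪_⟫ = Vec.tabulate (does ∘ P?)

  ∈⟪⟫⁺ : ∀ {x} → P x → x ∈ ⟪_⟫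
  ∈⟪⟫⁺ {x} px = lookup⇒[]= x _ (trans (lookup∘tabulate (does ∘ P?) x) (dec-true (P? x) px))

  ∈⟪⟫⁻ : ∀ {x} → x ∈ ⟪_⟫ → P x
  ∈⟪⟫⁻ {x} x∈ = decidable-stable (P? x) λ ¬px → contradiction
    (trans (sym (dec-false (P? x) ¬px)) (trans (sym (lookup∘tabulate (does ∘ P?) x)) ([]=⇒lookup x∈)))
    λ ()

BoundedGrid : ∀ {n} → Graph n → ℕ → Set
BoundedGrid {n} G b = Σ[ l ∈ (Fin n → Fin b → ℕ) ] Σ[ h ∈ (Fin n → Fin b → ℕ) ]
  (∀ u i → l u i < 2 + n) × (∀ u i → h u i < 2 + n) × IsGridRepresentation G l h

-- lo u is replaced by 1 + #{w : lo w < lo u} and hi v by #{w : lo w ≤ hi v}.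
module Ranks {n b} (G : Graph n) (B : Fin n → Box b)
  (ll? : ∀ u w i → Dec (lo (B u) i ≤ᴿ lo (B w) i))
  (lh? : ∀ u w i → Dec (lo (B u) i ≤ᴿ hi (B w) i))
  (rep : IsBoxRepresentation G B) where

  below : Fin n → Fin b → Subset n
  below u i = ⟪ (λ w → ¬? (ll? u w i)) ⟫

  upto : Fin n → Fin b → Subset n
  upto v i = ⟪ (λ w → lh? w v i) ⟫

  l h : Fin n → Fin b → ℕ
  l u i = suc ∣ below u i ∣
  h v i = ∣ upto v i ∣

  to : ∀ u v i → lo (B u) i ≤ᴿ hi (B v) i → l u i ≤ h v i
  to u v i lu≤hv = p⊂q⇒∣p∣<∣q∣
    ( (λ {w} w∈ → ∈⟪⟫⁺ (λ w → lh? w v i)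
        (≤ᴿ-trans {lo (B w) i} {lo (B u) i} {hi (B v) i}
          (≰ᴿ⇒≥ᴿ {lo (B u) i} {lo (B w) i} (∈⟪⟫⁻ (λ w → ¬? (ll? u w i)) w∈)) lu≤hv))
    , u , ∈⟪⟫⁺ (λ w → lh? w v i) lu≤hv
    , λ u∈ → ∈⟪⟫⁻ (λ w → ¬? (ll? u w i)) u∈ (≤ᴿ-refl {lo (B u) i}))

  from : ∀ u v i → l u i ≤ h v i → lo (B u) i ≤ᴿ hi (B v) i
  from u v i lt = decidable-stable (lh? u v i) λ lu≰hv → ℕₚ.<⇒≱ lt (p⊆q⇒∣p∣≤∣q∣
    λ {w} w∈ → ∈⟪⟫⁺ (λ w → ¬? (ll? u w i)) λ lu≤lw → lu≰hv
      (≤ᴿ-trans {lo (B u) i} {lo (B w) i} {hi (B v) i} lu≤lw (∈⟪⟫⁻ (λ w → lh? w v i) w∈)))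

  meet : ∀ u v → Overlap l h u v → Intersect (B u) (B v)
  meet u v o = (λ i → proj₁ (pt i)) , (λ i → proj₁ (proj₂ (pt i))) , (λ i → proj₂ (proj₂ (pt i)))
    where
    pt : ∀ i → Σ[ x ∈ ℝ ] (lo (B u) i ≤ᴿ x × x ≤ᴿ hi (B u) i) × (lo (B v) i ≤ᴿ x × x ≤ᴿ hi (B v) i)
    pt i with ll? u v i
    ... | yes lu≤lv = lo (B v) i , (lu≤lv , from v u i (proj₂ (o i))) ,
                      (≤ᴿ-refl {lo (B v) i} , lo≤hi (B v) i)
    ... | no  lu≰lv = lo (B u) i , (≤ᴿ-refl {lo (B u) i} , lo≤hi (B u) i) ,
                      (≰ᴿ⇒≥ᴿ {lo (B u) i} {lo (B v) i} lu≰lv , from u v i (proj₁ (o i)))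

  grid : BoundedGrid G b
  grid = l , h
    , (λ u i → s≤s (s≤s (∣p∣≤n (below u i))))
    , (λ u i → ℕₚ.m≤n⇒m≤1+n (s≤s (∣p∣≤n (upto u i))))
    , (λ u i → to u u i (lo≤hi (B u) i))
    , λ u v u≢v → mk⇔
        (λ uv i → let p , p∈u , p∈v = Equivalence.to (rep u v u≢v) uv in
          to u v i (≤ᴿ-trans {lo (B u) i} {p i} {hi (B v) i} (proj₁ (p∈u i)) (proj₂ (p∈v i))) ,
          to v u i (≤ᴿ-trans {lo (B v) i} {p i} {hi (B u) i} (proj₁ (p∈v i)) (proj₂ (p∈u i))))
        (Equivalence.from (rep u v u≢v) ∘ meet u v)

box⇒¬¬grid : ∀ {n b} (G : Graph n) → HasBoxRepresentation G b → ¬ ¬ BoundedGrid G b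
box⇒¬¬grid G (B , rep) k =
  ¬¬-∀ (λ u → ¬¬-∀ λ w → ¬¬-∀ λ i → ¬¬-excluded-middle) λ ll? →
  ¬¬-∀ (λ u → ¬¬-∀ λ w → ¬¬-∀ λ i → ¬¬-excluded-middle) λ lh? →
  k (Ranks.grid G B ll? lh? rep)

module _ {n} (G : Graph n) (b : ℕ) where

  private
    K : ℕ
    K = ((2 + n) ^ b) ^ n

    decode : Fin K → Fin n → Fin b → ℕ
    decode c u i = toℕ (finToFun {2 + n} {b} (finToFun {(2 + n) ^ b} {n} c u) i)

    encode : (f : Fin n → Fin b → ℕ) → (∀ u i → f u i < 2 + n) → Fin K
    encode f f< = funToFin λ u → funToFin λ i → fromℕ< (f< u i)

    decode-encode : ∀ f f< u i → decode (encode f f<) u i ≡ f u i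
    decode-encode f f< u i = trans
      (cong (λ c → toℕ (finToFun {2 + n} {b} c i)) (finToFun-funToFin (λ u → funToFin λ i → fromℕ< (f< u i)) u))
      (trans (cong toℕ (finToFun-funToFin (λ i → fromℕ< (f< u i)) i)) (toℕ-fromℕ< (f< u i)))

    isGrid? : ∀ (l h : Fin n → Fin b → ℕ) → Dec (IsGridRepresentation G l h)
    isGrid? l h =
      (all? λ u → all? λ i → l u i ℕₚ.≤? h u i) ×-dec
      (all? λ u → all? λ v → ¬? (u Finₚ.≟ v) →-dec
        map′ (λ (f , g) → mk⇔ f g) (λ e → Equivalence.to e , Equivalence.from e)
          ((adj? G u v →-dec overlap? u v) ×-dec (overlap? u v →-dec adj? G u v)))
      where
      overlap? : ∀ u v → Dec (Overlap l h u v)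
      overlap? u v = all? λ i → (l u i ℕₚ.≤? h v i) ×-dec (l v i ℕₚ.≤? h u i)

    transport : ∀ {l h l′ h′ : Fin n → Fin b → ℕ} →
                (∀ u i → l u i ≡ l′ u i) → (∀ u i → h u i ≡ h′ u i) →
                IsGridRepresentation G l h → IsGridRepresentation G l′ h′
    transport l≡ h≡ (l≤h , rep) =
      (λ u i → subst₂ _≤_ (l≡ u i) (h≡ u i) (l≤h u i)) ,
      λ u v u≢v → mk⇔
        (λ uv i → let a , c = Equivalence.to (rep u v u≢v) uv i in
          subst₂ _≤_ (l≡ u i) (h≡ v i) a , subst₂ _≤_ (l≡ v i) (h≡ u i) c)
        (λ o → Equivalence.from (rep u v u≢v) λ i →
          subst₂ _≤_ (sym (l≡ u i)) (sym (h≡ v i)) (proj₁ (o i)) ,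
          subst₂ _≤_ (sym (l≡ v i)) (sym (h≡ u i)) (proj₂ (o i)))

  hasBoxRepresentation? : Dec (HasBoxRepresentation G b)
  hasBoxRepresentation? with any? (λ c → any? λ d → isGrid? (decode c) (decode d))
  ... | yes (_ , _ , g) = yes (grid⇒box G g)
  ... | no ¬g = no λ r → box⇒¬¬grid G r λ (l , h , l< , h< , g) →
    ¬g (encode l l< , encode h h< ,
        transport (λ u i → sym (decode-encode l l< u i)) (λ u i → sym (decode-encode h h< u i)) g)

-- Coordinate w separates w, placed at 0, from its non-neighbours, placed at 1;
-- its neighbours get [0,1].
hasBoxRepresentation-n : ∀ {n} (G : Graph n) → HasBoxRepresentation G n
hasBoxRepresentation-n {n} G = grid⇒box G {l} {h} (l≤h , λ u v u≢v → mk⇔ (to u v) (from u v u≢v))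
  where
  l h : Fin n → Fin n → ℕ
  l u w with u Finₚ.≟ w | adj? G u w
  ... | yes _ | _     = 0
  ... | no  _ | yes _ = 0
  ... | no  _ | no  _ = 1
  h u w with u Finₚ.≟ w
  ... | yes _ = 0
  ... | no  _ = 1

  l≤h : ∀ u w → l u w ≤ h u w
  l≤h u w with u Finₚ.≟ w | adj? G u w
  ... | yes _ | _     = z≤n
  ... | no  _ | yes _ = z≤n
  ... | no  _ | no  _ = s≤s z≤n

  half : ∀ u v → Adj G u v → ∀ w → l u w ≤ h v w
  half u v uv w with u Finₚ.≟ w | adj? G u w | v Finₚ.≟ w
  ... | yes _ | _      | _        = z≤n
  ... | no  _ | yes _  | _        = z≤n
  ... | no  _ | no _   | no _     = s≤s z≤n
  ... | no  _ | no ¬uw | yes refl = contradiction uv ¬uw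

  to : ∀ u v → Adj G u v → Overlap l h u v
  to u v uv w = half u v uv w , half v u (symm G uv) w

  sep : ∀ u v → u ≢ v → l u v ≤ h v v → Adj G u v
  sep u v u≢v le with u Finₚ.≟ v | adj? G u v | v Finₚ.≟ v
  ... | yes u≡v | _      | _      = contradiction u≡v u≢v
  ... | no  _   | yes uv | _      = uv
  ... | no  _   | no  _  | no v≢v = contradiction refl v≢v
  sep u v u≢v () | no _ | no _ | yes _

  from : ∀ u v → u ≢ v → Overlap l h u v → Adj G u v
  from u v u≢v o = sep u v u≢v (proj₁ (o v))

leastBoxDimension : ∀ {n} (G : Graph n) → ∃ (IsLeast (HasBoxRepresentation G))
leastBoxDimension {n} G = least (hasBoxRepresentation? G) n (hasBoxRepresentation-n G)

box : ∀ {n} → Graph n → ℕ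
box G = proj₁ (leastBoxDimension G)

box-isLeast : ∀ {n} (G : Graph n) → IsLeast (HasBoxRepresentation G) (box G)
box-isLeast G = proj₂ (leastBoxDimension G)

{-# OPTIONS --safe #-}
-- A graph has boxicity at most b as soon as b interval supergraphs of it
-- separate, between them, all pairs of distinct non-adjacent vertices.
--
-- For MED (complement G): a non-edge {a , b} of G yields one interval
-- supergraph separating both a and b from all their non-neighbours, and the
-- endpoints of a dominating edge set of the complement meet every non-edge.
--
-- For 2 * MED G + 2: the endpoints of a dominating edge set of G form a vertex
-- cover S of size 2 * MED G.  One interval supergraph per s ∈ S separates s
-- from its non-neighbours, and a single further one places the independent
-- vertices outside S at distinct points, so that even 2 * MED G + 1 suffices.
module Submission where

open import Defs
open import Data.Bool.Base using (true; false)
open import Data.Fin.Base using (Fin; zero; suc; toℕ)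
open import Data.Fin.Properties using (_≟_; toℕ≤n; <-cmp; _<?_)
open import Data.Fin.Subset using (Subset; ∣_∣) renaming (_∈_ to _∈ˢ_)
open import Data.Fin.Subset.Properties using () renaming (_∈?_ to _∈ˢ?_)
open import Data.List.Base using (List; []; _∷_; length; lookup; map; allFin; cartesianProduct)
open import Data.List.Membership.DecPropositional using () renaming (_∈?_ to member?)
open import Data.List.Membership.Propositional using (_∈_; lose)
open import Data.List.Membership.Propositional.Properties using (∈-map⁺; ∈-filter⁺; ∈-filter⁻; ∈-cartesianProduct⁺; ∈-allFin; ∈-lookup)
open import Data.List.Properties using (length-map)
open import Data.List.Relation.Unary.Any as Any using (Any; here; there)
open import Data.List.Relation.Unary.Any.Properties using (lookup-index)
open import Data.Nat.Base using (ℕ; _+_; _*_; _⊓_; _≤_; _<_; z≤n; s≤s)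
open import Data.Nat.Properties using (≤-refl; ≤-reflexive; ≤-trans; m≤n+m; <⇒≱; *-suc; +-comm; ⊓-glb)
open import Data.Product.Base using (∃-syntax; _×_; _,_; proj₁; proj₂)
open import Data.Sum.Base as Sum using (_⊎_; inj₁; inj₂)
open import Data.Vec.Base using () renaming ([] to []ᵛ; _∷_ to _∷ᵛ_; here to hereᵛ; there to thereᵛ)
open import Function.Base using (_∘_)
open import Function.Bundles using (mk⇔)
open import Relation.Binary.Definitions using (tri<; tri≈; tri>)
open import Relation.Binary.PropositionalEquality using (_≡_; _≢_; refl; sym; trans; cong; subst)
open import Relation.Nullary using (¬_; yes; no; contradiction)
open import Relation.Nullary.Decidable using (decidable-stable; _×-dec_)

-- Interval supergraphs and boxicity

private
  variable
    n : ℕ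

-- `covers` gives one inequality per ordered pair; symmetry of `Adj` supplies the other half of the
-- overlap.
record IntervalSupergraph (G : Graph n) : Set where
  field
    left right : Fin n → ℕ
    left≤right : ∀ u → left u ≤ right u
    covers     : ∀ {u v} → Adj G u v → left u ≤ right v

open IntervalSupergraph

Separates : {G : Graph n} → Fin n → Fin n → IntervalSupergraph G → Set
Separates u v I = right I v < left I u ⊎ right I u < left I v

Separates-sym : {G : Graph n} {u v : Fin n} {I : IntervalSupergraph G} →
                Separates u v I → Separates v u I
Separates-sym = Sum.swap

-- Each supergraph serves as one coordinate: adjacent vertices overlap in all of them, and a
-- non-adjacent pair is disjoint in the one that separates it.
supergraphs⇒box≤ : (G : Graph n) (Is : List (IntervalSupergraph G)) →
                   (∀ {u v} → u ≢ v → ¬ Adj G u v → Any (Separates u v) Is) →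
                   box G ≤ length Is
supergraphs⇒box≤ {n} G Is separated =
  proj₂ (box-isLeast G) (length Is)
    (grid⇒box G ((λ u i → left≤right (lookup Is i) u) ,
                 λ u v u≢v → mk⇔ overlapping (adjacent u≢v)))
  where
  l h : Fin n → Fin (length Is) → ℕ
  l u i = left (lookup Is i) u
  h u i = right (lookup Is i) u

  overlapping : ∀ {u v} → Adj G u v → Overlap l h u v
  overlapping uv i = covers (lookup Is i) uv , covers (lookup Is i) (symm G uv)

  adjacent : ∀ {u v} → u ≢ v → Overlap l h u v → Adj G u v
  adjacent {u} {v} u≢v o = decidable-stable (adj? G u v) λ ¬uv →
    let s = separated u≢v ¬uv
        lu≤hv , lv≤hu = o (Any.index s)
    in Sum.[ (λ hv<lu → <⇒≱ hv<lu lu≤hv) , (λ hu<lv → <⇒≱ hu<lv lv≤hu) ]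
         (lookup-index s)

-- Supergraphs attached to a non-edge, a vertex and a vertex cover

-- a is placed at 0, b at 3, and every other interval contains [1,2], extended
-- to 0 for neighbours of a and to 3 for neighbours of b.
module NonEdge (G : Graph n) {a b : Fin n} (a≢b : a ≢ b) (¬ab : ¬ Adj G a b) where

  private
    l h : Fin n → ℕ
    l w with w ≟ b | w ≟ a | adj? G a w
    ... | yes _ | _     | _     = 3
    ... | no _  | yes _ | _     = 0
    ... | no _  | no _  | yes _ = 0
    ... | no _  | no _  | no _  = 1
    h w with w ≟ a | w ≟ b | adj? G b w
    ... | yes _ | _     | _     = 0
    ... | no _  | yes _ | _     = 3
    ... | no _  | no _  | yes _ = 3
    ... | no _  | no _  | no _  = 2

    l≤h : ∀ w → l w ≤ h w
    l≤h w with w ≟ b | w ≟ a | adj? G a w | adj? G b w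
    -- Here `l` would be 3 and `h` would be 0.
    ... | yes w≡b | yes w≡a | _     | _     = contradiction (trans (sym w≡a) w≡b) a≢b
    ... | yes _   | no _    | _     | _     = ≤-refl
    ... | no _    | yes _   | _     | _     = z≤n
    ... | no _    | no _    | yes _ | _     = z≤n
    ... | no _    | no _    | no _  | yes _ = s≤s z≤n
    ... | no _    | no _    | no _  | no _  = s≤s z≤n

    l≤h-adj : ∀ {u v} → Adj G u v → l u ≤ h v
    l≤h-adj {u} {v} uv with u ≟ b | u ≟ a | adj? G a u | v ≟ a | v ≟ b | adj? G b v
    -- The dangerous cases have `u` starting beyond the end of `v`: each would need an edge from `a`
    -- or `b` to one of its non-neighbours.
    ... | yes refl | _     | _      | yes refl | _     | _      = contradiction (symm G uv) ¬ab
    ... | yes refl | _     | _      | no _     | yes _ | _      = ≤-refl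
    ... | yes refl | _     | _      | no _     | no _  | yes _  = ≤-refl
    ... | yes refl | _     | _      | no _     | no _  | no ¬bv = contradiction uv ¬bv
    ... | no _     | yes _ | _      | _        | _     | _      = z≤n
    ... | no _     | no _  | yes _  | _        | _     | _      = z≤n
    ... | no _     | no _  | no ¬au | yes refl | _     | _      = contradiction (symm G uv) ¬au
    ... | no _     | no _  | no _   | no _     | yes _ | _      = s≤s z≤n
    ... | no _     | no _  | no _   | no _     | no _  | yes _  = s≤s z≤n
    ... | no _     | no _  | no _   | no _     | no _  | no _   = s≤s z≤n

  supergraph : IntervalSupergraph G
  supergraph = record { left = l ; right = h ; left≤right = l≤h ; covers = l≤h-adj }

  -- `a` ends at 0, while a vertex other than `a` and its neighbours starts at 1, or at 3 if it is
  -- `b`.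
  separates-a : ∀ {w} → a ≢ w → ¬ Adj G a w → Separates a w supergraph
  separates-a {w} a≢w ¬aw = inj₂ ha<lw
    where
    ha<lw : h a < l w
    ha<lw with a ≟ a | w ≟ b | w ≟ a | adj? G a w
    ... | no a≢a | _     | _       | _      = contradiction refl a≢a
    ... | yes _  | yes _ | _       | _      = s≤s z≤n
    ... | yes _  | no _  | yes w≡a | _      = contradiction (sym w≡a) a≢w
    ... | yes _  | no _  | no _    | yes aw = contradiction aw ¬aw
    ... | yes _  | no _  | no _    | no _   = s≤s z≤n

  separates-b : ∀ {w} → b ≢ w → ¬ Adj G b w → Separates b w supergraph
  separates-b {w} b≢w ¬bw = inj₁ hw<lb
    where
    hw<lb : h w < l b
    hw<lb with b ≟ b | w ≟ a | w ≟ b | adj? G b w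
    ... | no b≢b | _     | _       | _      = contradiction refl b≢b
    ... | yes _  | yes _ | _       | _      = s≤s z≤n
    ... | yes _  | no _  | yes w≡b | _      = contradiction (sym w≡b) b≢w
    ... | yes _  | no _  | no _    | yes bw = contradiction bw ¬bw
    ... | yes _  | no _  | no _    | no _   = ≤-refl

  separates-endpoint : ∀ {x w} → EndpointOf x (a , b) → x ≢ w → ¬ Adj G x w →
                       Separates x w supergraph
  separates-endpoint (inj₁ refl) = separates-a
  separates-endpoint (inj₂ refl) = separates-b

-- `s` gets the point 0, its neighbours get [0,1], and all other vertices the point 1, so only
-- non-edges at `s` are separated.
module Vertex (G : Graph n) (s : Fin n) where

  private
    l h : Fin n → ℕ
    l w with w ≟ s | adj? G s w
    ... | yes _ | _     = 0
    ... | no _  | yes _ = 0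
    ... | no _  | no _  = 1
    h w with w ≟ s
    ... | yes _ = 0
    ... | no _  = 1

    l≤h : ∀ w → l w ≤ h w
    l≤h w with w ≟ s | adj? G s w
    ... | yes _ | _     = z≤n
    ... | no _  | yes _ = z≤n
    ... | no _  | no _  = ≤-refl

    l≤h-adj : ∀ {u v} → Adj G u v → l u ≤ h v
    l≤h-adj {u} {v} uv with u ≟ s | adj? G s u | v ≟ s
    ... | yes _ | _      | _        = z≤n
    ... | no _  | yes _  | _        = z≤n
    ... | no _  | no ¬su | yes refl = contradiction (symm G uv) ¬su
    ... | no _  | no _   | no _     = ≤-refl

  supergraph : IntervalSupergraph G
  supergraph = record { left = l ; right = h ; left≤right = l≤h ; covers = l≤h-adj }

  separates : ∀ {w} → s ≢ w → ¬ Adj G s w → Separates s w supergraph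
  separates {w} s≢w ¬sw = inj₂ hs<lw
    where
    hs<lw : h s < l w
    hs<lw with s ≟ s | w ≟ s | adj? G s w
    ... | no s≢s | _       | _      = contradiction refl s≢s
    ... | yes _  | yes w≡s | _      = contradiction (sym w≡s) s≢w
    ... | yes _  | no _    | yes sw = contradiction sw ¬sw
    ... | yes _  | no _    | no _   = ≤-refl

IsVertexCover : Graph n → List (Fin n) → Set
IsVertexCover G S = ∀ {u v} → Adj G u v → u ∈ S ⊎ v ∈ S

-- Vertices of `S` get [0,n], which contains every point `toℕ w`; the remaining vertices can sit at
-- distinct points because no edge avoids `S`.
module Independent (G : Graph n) {S : List (Fin n)} (cover : IsVertexCover G S) where

  private
    l h : Fin n → ℕ
    l w with member? _≟_ w S
    ... | yes _ = 0
    ... | no _  = toℕ w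
    h w with member? _≟_ w S
    ... | yes _ = n
    ... | no _  = toℕ w

    l≤h : ∀ w → l w ≤ h w
    l≤h w with member? _≟_ w S
    ... | yes _ = z≤n
    ... | no _  = ≤-refl

    l≤h-adj : ∀ {u v} → Adj G u v → l u ≤ h v
    l≤h-adj {u} {v} uv with member? _≟_ u S | member? _≟_ v S
    ... | yes _  | _      = z≤n
    ... | no _   | yes _  = toℕ≤n u
    ... | no u∉S | no v∉S = contradiction (cover uv) Sum.[ u∉S , v∉S ]

  supergraph : IntervalSupergraph G
  supergraph = record { left = l ; right = h ; left≤right = l≤h ; covers = l≤h-adj }

  separates : ∀ {u v} → u ≢ v → ¬ u ∈ S → ¬ v ∈ S → Separates u v supergraph
  separates {u} {v} u≢v u∉S v∉S with member? _≟_ u S | member? _≟_ v S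
  ... | yes u∈S | _       = contradiction u∈S u∉S
  ... | no _    | yes v∈S = contradiction v∈S v∉S
  ... | no _    | no _    with <-cmp u v
  ...   | tri< u<v _ _ = inj₂ u<v
  ...   | tri≈ _ u≡v _ = contradiction u≡v u≢v
  ...   | tri> _ _ v<u = inj₁ v<u

-- A non-adjacent pair meeting `S` is separated by the supergraph of its member in `S`; a pair
-- outside `S` by the extra one.
vertexCover⇒box≤ : (G : Graph n) {S : List (Fin n)} → IsVertexCover G S →
                   box G ≤ 1 + length S
vertexCover⇒box≤ G {S} cover =
  subst (box G ≤_) (cong (1 +_) (length-map (Vertex.supergraph G) S))
    (supergraphs⇒box≤ G (Independent.supergraph G cover ∷ map (Vertex.supergraph G) S) separated)
  where
  separated : ∀ {u v} → u ≢ v → ¬ Adj G u v →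
              Any (Separates u v) (Independent.supergraph G cover ∷ map (Vertex.supergraph G) S)
  separated {u} {v} u≢v ¬uv with member? _≟_ u S | member? _≟_ v S
  ... | yes u∈S | _       = there (lose (∈-map⁺ (Vertex.supergraph G) u∈S) (Vertex.separates G u u≢v ¬uv))
  ... | no _    | yes v∈S = there (lose (∈-map⁺ (Vertex.supergraph G) v∈S)
                              (Separates-sym {I = Vertex.supergraph G v}
                                (Vertex.separates G v (u≢v ∘ sym) (¬uv ∘ symm G))))
  ... | no u∉S  | no v∉S  = here (Independent.separates G cover u≢v u∉S v∉S)

-- Edge sets and their endpoints as lists

elements : Subset n → List (Fin n)
elements []ᵛ          = []
elements (true ∷ᵛ p)  = zero ∷ map suc (elements p)
elements (false ∷ᵛ p) = map suc (elements p)

length-elements : (p : Subset n) → length (elements p) ≡ ∣ p ∣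
length-elements []ᵛ          = refl
length-elements (true ∷ᵛ p)  = cong (1 +_) (trans (length-map suc (elements p)) (length-elements p))
length-elements (false ∷ᵛ p) = trans (length-map suc (elements p)) (length-elements p)

∈-elements : {p : Subset n} {x : Fin n} → x ∈ˢ p → x ∈ elements p
∈-elements                    hereᵛ       = here refl
∈-elements {p = true ∷ᵛ _}  (thereᵛ x∈p) = there (∈-map⁺ suc (∈-elements x∈p))
∈-elements {p = false ∷ᵛ _} (thereᵛ x∈p) = ∈-map⁺ suc (∈-elements x∈p)

-- Repeated vertices are kept, so that the length is exactly twice the number of edges.
endpoints : List (Fin n × Fin n) → List (Fin n)
endpoints []             = []
endpoints ((u , v) ∷ es) = u ∷ v ∷ endpoints es

length-endpoints : (es : List (Fin n × Fin n)) → length (endpoints es) ≡ 2 * length es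
length-endpoints []       = refl
length-endpoints (_ ∷ es) = trans (cong (2 +_) (length-endpoints es)) (sym (*-suc 2 (length es)))

∈-endpoints : {es : List (Fin n × Fin n)} {e : Fin n × Fin n} {w : Fin n} →
              e ∈ es → EndpointOf w e → w ∈ endpoints es
∈-endpoints (here refl)  (inj₁ refl) = here refl
∈-endpoints (here refl)  (inj₂ refl) = there (here refl)
∈-endpoints (there e∈es) w∈e         = there (there (∈-endpoints e∈es w∈e))

-- Dominating edge sets meet every edge

ends : (G : Graph n) → EdgeIx G → Fin n × Fin n
ends G = lookup (edges G)

ends-adjacent : (G : Graph n) (e : EdgeIx G) → Adj G (proj₁ (ends G e)) (proj₂ (ends G e))
ends-adjacent G e = proj₂ (proj₂ (∈-filter⁻ (λ (u , v) → (u <? v) ×-dec adj? G u v)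
  {xs = cartesianProduct (allFin _) (allFin _)} (∈-lookup {xs = edges G} e)))

-- `edges` stores the smaller endpoint first, so the order of `u` and `v` decides whether the stored
-- pair is swapped.
edgeBetween : (G : Graph n) {u v : Fin n} → Adj G u v →
              ∃[ e ] (∀ {w} → EndpointOf w (ends G e) → w ≡ u ⊎ w ≡ v)
edgeBetween G {u} {v} uv with <-cmp u v
... | tri≈ _ refl _ = contradiction uv (irrefl G u)
... | tri< u<v _ _ = Any.index e∈ , subst (EndpointOf _) (sym (lookup-index e∈))
  where
  e∈ : (u , v) ∈ edges G
  e∈ = ∈-filter⁺ _ (∈-cartesianProduct⁺ (∈-allFin u) (∈-allFin v)) (u<v , uv)
... | tri> _ _ v<u = Any.index e∈ , Sum.swap ∘ subst (EndpointOf _) (sym (lookup-index e∈))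
  where
  e∈ : (v , u) ∈ edges G
  e∈ = ∈-filter⁺ _ (∈-cartesianProduct⁺ (∈-allFin v) (∈-allFin u)) (v<u , symm G uv)

-- The edge `uv` is in `D` or shares a vertex with some edge of `D`, and that vertex can only be `u`
-- or `v`.
dominating⇒meets : (G : Graph n) {D : EdgeSet G} → Dominating G D → ∀ {u v} → Adj G u v →
                   ∃[ d ] d ∈ˢ D × (EndpointOf u (ends G d) ⊎ EndpointOf v (ends G d))
dominating⇒meets G {D} dom {u} {v} uv with edgeBetween G uv
... | e , onlyEnds = meets
  where
  endOf : ∀ {w d} → EndpointOf w (ends G e) → EndpointOf w (ends G d) →
          EndpointOf u (ends G d) ⊎ EndpointOf v (ends G d)
  endOf w∈e w∈d with onlyEnds w∈e
  ... | inj₁ refl = inj₁ w∈d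
  ... | inj₂ refl = inj₂ w∈d

  meets : ∃[ d ] d ∈ˢ D × (EndpointOf u (ends G d) ⊎ EndpointOf v (ends G d))
  meets with e ∈ˢ? D
  -- Any endpoint of `e` will do; the first is taken.
  ... | yes e∈D = e , e∈D , endOf {d = e} (inj₁ refl) (inj₁ refl)
  ... | no e∉D  = let d , d∈D , _ , w∈e , w∈d = dom e e∉D in d , d∈D , endOf {d = d} w∈e w∈d

-- The two bounds

dominating⇒box≤ : (G : Graph n) {D : EdgeSet G} → Dominating G D → box G ≤ 1 + 2 * ∣ D ∣
dominating⇒box≤ {n} G {D} dom =
  subst (λ m → box G ≤ 1 + m) length-S (vertexCover⇒box≤ G {S} cover)
  where
  es : List (Fin n × Fin n)
  es = map (ends G) (elements D)

  S : List (Fin n)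
  S = endpoints es

  length-S : length S ≡ 2 * ∣ D ∣
  length-S = trans (length-endpoints es)
    (cong (2 *_) (trans (length-map (ends G) (elements D)) (length-elements D)))

  cover : IsVertexCover G S
  cover uv = let d , d∈D , u∈d⊎v∈d = dominating⇒meets G dom uv
                 d∈es = ∈-map⁺ (ends G) (∈-elements d∈D)
             in Sum.map (∈-endpoints d∈es) (∈-endpoints d∈es) u∈d⊎v∈d

dominatingComplement⇒box≤ : (G : Graph n) {D : EdgeSet (complement G)} →
                            Dominating (complement G) D → box G ≤ ∣ D ∣
dominatingComplement⇒box≤ {n} G {D} dom =
  subst (box G ≤_) (trans (length-map I (elements D)) (length-elements D))
    (supergraphs⇒box≤ G (map I (elements D)) separated)
  where
  -- Adjacency in the complement is exactly the pair of hypotheses `NonEdge` asks for.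
  module Sep (d : EdgeIx (complement G)) =
    NonEdge G (proj₁ (ends-adjacent (complement G) d)) (proj₂ (ends-adjacent (complement G) d))

  I : EdgeIx (complement G) → IntervalSupergraph G
  I = Sep.supergraph

  separated : ∀ {u v} → u ≢ v → ¬ Adj G u v → Any (Separates u v) (map I (elements D))
  separated u≢v ¬uv with dominating⇒meets (complement G) dom (u≢v , ¬uv)
  ... | d , d∈D , inj₁ u∈d = lose (∈-map⁺ I (∈-elements d∈D)) (Sep.separates-endpoint d u∈d u≢v ¬uv)
  ... | d , d∈D , inj₂ v∈d = lose (∈-map⁺ I (∈-elements d∈D))
      (Separates-sym {I = I d} (Sep.separates-endpoint d v∈d (u≢v ∘ sym) (¬uv ∘ symm G)))

theorem17 : (n : ℕ) (G : Graph n) → box G ≤ (2 * MED G + 2) ⊓ MED (complement G)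
theorem17 n G with proj₁ (MED-isLeast G) | proj₁ (MED-isLeast (complement G))
... | D , dom , ∣D∣≡ | D′ , dom′ , ∣D′∣≡ = ⊓-glb
  -- The bound 1 + 2 * `MED G` is weakened by one.
  (≤-trans (subst (λ k → box G ≤ 1 + 2 * k) ∣D∣≡ (dominating⇒box≤ G dom))
           (≤-trans (m≤n+m _ 1) (≤-reflexive (+-comm 2 _))))
  (subst (box G ≤_) ∣D′∣≡ (dominatingComplement⇒box≤ G dom′))
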